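{- For every integer $t\ge 3$, there exist two pairs of non $\epsilon$-cospectral $\epsilon$-equienergetic graphs on $6+6t$ vertices.
   Context: All graphs are finite, simple, undirected and connected. For a connected graph $G$ with distance function $d$, the eccentricity of a vertex $v$ is $e(v)=\max\{d(v,u):u\in V(G)\}$. The eccentricity matrix $\epsilon(G)$ is the symmetric matrix indexed by $V(G)$ with $(u,v)$ entry $d(u,v)$ if $d(u,v)=\min\{e(u),e(v)\}$, and $0$ otherwise. The $\epsilon$-spectrum of $G$ is the multiset of eigenvalues of $\epsilon(G)$, and the $\epsilon$-energy is the sum of the absolute values of these eigenvalues (with multiplicity). Two non-isomorphic graphs of the same order are $\epsilon$-cospectral if they have the same $\epsilon$-spectrum, and non $\epsilon$-cospectral otherwise. Two graphs of the same order are $\epsilon$-equienergetic if they have the same $\epsilon$-energy. "Two pairs" means two different (unordered) pairs of graphs up to isomorphism, each pair consisting of two graphs that are non $\epsilon$-cospectral and $\epsilon$-equienergetic. -}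

module Defs where

open import Level using (0ℓ)
open import Data.Bool.Base using (if_then_else_)
open import Data.Nat.Base as ℕ using (ℕ; zero; suc; z≤n; s≤s)
import Data.Nat.Properties as ℕ
open import Data.Integer.Base using (+_)
open import Data.Rational.Base as ℚ using (ℚ; 0ℚ; 1ℚ; ½)
import Data.Rational.Properties as ℚ
open import Data.Rational.Solver using (module +-*-Solver)
open import Data.Fin.Base using (Fin; zero; suc; toℕ; punchIn)
open import Data.Fin.Properties using (_≟_; any?)
open import Data.Fin.Permutation using (Permutation′; _⟨$⟩ʳ_)
open import Data.Vec.Functional using (Vector; foldr)
open import Data.Product.Base using (∃; ∃-syntax; _×_; _,_; proj₁; proj₂)
open import Data.Sum.Base using (_⊎_; inj₁; inj₂)
open import Function.Base using (_∘_)
open import Function.Bundles using (_⇔_)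
open import Relation.Nullary using (¬_; Dec; yes; no; does; contradiction)
open import Relation.Nullary.Decidable using (_×-dec_)
open import Relation.Unary using (Pred)
import Relation.Unary as U
open import Relation.Binary.Core using (Rel)
open import Relation.Binary.Definitions using (Decidable; Symmetric; Irreflexive)
open import Relation.Binary.Structures using (IsEquivalence)
open import Relation.Binary.PropositionalEquality
  using (_≡_; refl; sym; cong; cong₂; subst; subst₂)
open import Algebra.Bundles using (CommutativeRing; Semiring)
import Algebra.Definitions.RawSemiring as RawSemiringDefs

private
  infix 4 _<_ _≤_
  _<_ = ℚ._<_
  _≤_ = ℚ._≤_

  ∥_-_∥ : ℚ → ℚ → ℚ
  ∥ p - q ∥ = ℚ.∣ p ℚ.- q ∣

  ½-pos : ∀ {ε} → 0ℚ < ε → 0ℚ < ½ ℚ.* ε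
  ½-pos {ε} ε>0 = subst (_< ½ ℚ.* ε) (ℚ.*-zeroʳ ½) (ℚ.*-monoʳ-<-pos ½ ε>0)

  ½+½ : ∀ ε → ½ ℚ.* ε ℚ.+ ½ ℚ.* ε ≡ ε
  ½+½ = solve 1 (λ e → con ½ :* e :+ con ½ :* e := e) refl
    where open +-*-Solver

  ∥-∥-sym : ∀ p q → ∥ p - q ∥ ≡ ∥ q - p ∥
  ∥-∥-sym p q = begin
    ℚ.∣ p ℚ.- q ∣          ≡⟨ cong ℚ.∣_∣ (lem p q) ⟩
    ℚ.∣ ℚ.- (q ℚ.- p) ∣    ≡⟨ ℚ.∣-p∣≡∣p∣ (q ℚ.- p) ⟩
    ℚ.∣ q ℚ.- p ∣          ∎
    where
    open Relation.Binary.PropositionalEquality.≡-Reasoning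
    open +-*-Solver
    lem : ∀ p q → p ℚ.- q ≡ ℚ.- (q ℚ.- p)
    lem = solve 2 (λ p q → p :- q := :- (q :- p)) refl

  ∥-∥-triangle : ∀ p q r → ∥ p - r ∥ ≤ ∥ p - q ∥ ℚ.+ ∥ q - r ∥
  ∥-∥-triangle p q r = subst (λ s → ℚ.∣ s ∣ ≤ ∥ p - q ∥ ℚ.+ ∥ q - r ∥) (lem p q r)
    (ℚ.∣p+q∣≤∣p∣+∣q∣ (p ℚ.- q) (q ℚ.- r))
    where
    open +-*-Solver
    lem : ∀ p q r → (p ℚ.- q) ℚ.+ (q ℚ.- r) ≡ p ℚ.- r
    lem = solve 3 (λ p q r → (p :- q) :+ (q :- r) := p :- r) refl

  ∥+∥ : ∀ p q p′ q′ → ∥ (p ℚ.+ q) - (p′ ℚ.+ q′) ∥ ≤ ∥ p - p′ ∥ ℚ.+ ∥ q - q′ ∥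
  ∥+∥ p q p′ q′ = subst (λ s → ℚ.∣ s ∣ ≤ ∥ p - p′ ∥ ℚ.+ ∥ q - q′ ∥) (lem p q p′ q′)
    (ℚ.∣p+q∣≤∣p∣+∣q∣ (p ℚ.- p′) (q ℚ.- q′))
    where
    open +-*-Solver
    lem : ∀ p q p′ q′ →
          (p ℚ.- p′) ℚ.+ (q ℚ.- q′) ≡ (p ℚ.+ q) ℚ.- (p′ ℚ.+ q′)
    lem = solve 4 (λ p q p′ q′ →
            (p :- p′) :+ (q :- q′) := (p :+ q) :- (p′ :+ q′)) refl

  ∥-_∥ : ∀ p q → ∥ (ℚ.- p) - (ℚ.- q) ∥ ≡ ∥ p - q ∥
  ∥-_∥ p q = begin
    ℚ.∣ ℚ.- p ℚ.- ℚ.- q ∣  ≡⟨ cong ℚ.∣_∣ (lem p q) ⟩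
    ∥ q - p ∥              ≡⟨ ∥-∥-sym q p ⟩
    ∥ p - q ∥              ∎
    where
    open Relation.Binary.PropositionalEquality.≡-Reasoning
    open +-*-Solver
    lem : ∀ p q → ℚ.- p ℚ.- ℚ.- q ≡ q ℚ.- p
    lem = solve 2 (λ p q → (:- p) :- (:- q) := q :- p) refl

  ∣p∣≤∣q∣+∥p-q∥ : ∀ p q → ℚ.∣ p ∣ ≤ ℚ.∣ q ∣ ℚ.+ ∥ p - q ∥
  ∣p∣≤∣q∣+∥p-q∥ p q = subst (λ s → ℚ.∣ s ∣ ≤ ℚ.∣ q ∣ ℚ.+ ∥ p - q ∥) (lem p q)
    (ℚ.∣p+q∣≤∣p∣+∣q∣ q (p ℚ.- q))
    where
    open +-*-Solver
    lem : ∀ p q → q ℚ.+ (p ℚ.- q) ≡ p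
    lem = solve 2 (λ p q → q :+ (p :- q) := p) refl

  ∣p∣-∣q∣≤∥p-q∥ : ∀ p q → ℚ.∣ p ∣ ℚ.- ℚ.∣ q ∣ ≤ ∥ p - q ∥
  ∣p∣-∣q∣≤∥p-q∥ p q = subst (ℚ.∣ p ∣ ℚ.- ℚ.∣ q ∣ ≤_) (lem ℚ.∣ q ∣ ∥ p - q ∥)
    (ℚ.+-monoˡ-≤ (ℚ.- ℚ.∣ q ∣) (∣p∣≤∣q∣+∥p-q∥ p q))
    where
    open +-*-Solver
    lem : ∀ q r → (q ℚ.+ r) ℚ.- q ≡ r
    lem = solve 2 (λ q r → (q :+ r) :- q := r) refl

  ∥∣∣∥ : ∀ p q → ∥ ℚ.∣ p ∣ - ℚ.∣ q ∣ ∥ ≤ ∥ p - q ∥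
  ∥∣∣∥ p q with ℚ.∣p∣≡p∨∣p∣≡-p (ℚ.∣ p ∣ ℚ.- ℚ.∣ q ∣)
  ... | inj₁ eq = subst (_≤ ∥ p - q ∥) (sym eq) (∣p∣-∣q∣≤∥p-q∥ p q)
  ... | inj₂ eq = subst₂ _≤_ (sym (Eq.trans eq (lem ℚ.∣ p ∣ ℚ.∣ q ∣))) (∥-∥-sym q p)
                    (∣p∣-∣q∣≤∥p-q∥ q p)
    where
    module Eq = Relation.Binary.PropositionalEquality
    open +-*-Solver
    lem : ∀ p q → ℚ.- (p ℚ.- q) ≡ q ℚ.- p
    lem = solve 2 (λ p q → :- (p :- q) := q :- p) refl

  ∥*∥ : ∀ p q p′ q′ →
        ∥ (p ℚ.* q) - (p′ ℚ.* q′) ∥ ≤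
        ℚ.∣ p ∣ ℚ.* ∥ q - q′ ∥ ℚ.+ ℚ.∣ q′ ∣ ℚ.* ∥ p - p′ ∥
  ∥*∥ p q p′ q′ = begin
    ℚ.∣ p ℚ.* q ℚ.- p′ ℚ.* q′ ∣
      ≡⟨ cong ℚ.∣_∣ (lem p q p′ q′) ⟩
    ℚ.∣ p ℚ.* (q ℚ.- q′) ℚ.+ q′ ℚ.* (p ℚ.- p′) ∣
      ≤⟨ ℚ.∣p+q∣≤∣p∣+∣q∣ (p ℚ.* (q ℚ.- q′)) (q′ ℚ.* (p ℚ.- p′)) ⟩
    ℚ.∣ p ℚ.* (q ℚ.- q′) ∣ ℚ.+ ℚ.∣ q′ ℚ.* (p ℚ.- p′) ∣
      ≡⟨ cong₂ ℚ._+_ (ℚ.∣p*q∣≡∣p∣*∣q∣ p (q ℚ.- q′)) (ℚ.∣p*q∣≡∣p∣*∣q∣ q′ (p ℚ.- p′)) ⟩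
    ℚ.∣ p ∣ ℚ.* ∥ q - q′ ∥ ℚ.+ ℚ.∣ q′ ∣ ℚ.* ∥ p - p′ ∥ ∎
    where
    open ℚ.≤-Reasoning
    open +-*-Solver
    lem : ∀ p q p′ q′ → p ℚ.* q ℚ.- p′ ℚ.* q′ ≡
          p ℚ.* (q ℚ.- q′) ℚ.+ q′ ℚ.* (p ℚ.- p′)
    lem = solve 4 (λ p q p′ q′ → p :* q :- p′ :* q′ :=
            p :* (q :- q′) :+ q′ :* (p :- p′)) refl

  shrink : ∀ {B} → 0ℚ < B → ∀ {ε} → 0ℚ < ε → ∃[ δ ] 0ℚ < δ ×
           (∀ {p d} → ℚ.∣ p ∣ ≤ B → 0ℚ ≤ d → d < δ → ℚ.∣ p ∣ ℚ.* d < ε)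
  shrink {B} B>0 {ε} ε>0 = 1/B ℚ.* ε , δ>0 , bound
    where
    instance
      B⁺ : ℚ.Positive B
      B⁺ = ℚ.positive B>0
      B≢0 : ℚ.NonZero B
      B≢0 = ℚ.pos⇒nonZero B
    1/B : ℚ
    1/B = ℚ.1/ B
    instance
      1/B⁺ : ℚ.Positive 1/B
      1/B⁺ = ℚ.1/pos⇒pos B
    δ>0 : 0ℚ < 1/B ℚ.* ε
    δ>0 = subst (_< 1/B ℚ.* ε) (ℚ.*-zeroʳ 1/B) (ℚ.*-monoʳ-<-pos 1/B ε>0)
    bound : ∀ {p d} → ℚ.∣ p ∣ ≤ B → 0ℚ ≤ d → d < 1/B ℚ.* ε → ℚ.∣ p ∣ ℚ.* d < ε
    bound {p} {d} p≤B 0≤d d<δ = begin-strict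
      ℚ.∣ p ∣ ℚ.* d        ≤⟨ ℚ.*-monoʳ-≤-nonNeg d {{ℚ.nonNegative 0≤d}} p≤B ⟩
      B ℚ.* d              <⟨ ℚ.*-monoʳ-<-pos B d<δ ⟩
      B ℚ.* (1/B ℚ.* ε)    ≡⟨ sym (ℚ.*-assoc B 1/B ε) ⟩
      B ℚ.* 1/B ℚ.* ε      ≡⟨ cong (ℚ._* ε) (ℚ.*-inverseʳ B) ⟩
      1ℚ ℚ.* ε             ≡⟨ ℚ.*-identityˡ ε ⟩
      ε                    ∎
      where open ℚ.≤-Reasoning

  split : ∀ {a b ε} → a < ½ ℚ.* ε → b < ½ ℚ.* ε → a ℚ.+ b < ε
  split {a} {b} {ε} a< b< = subst (a ℚ.+ b <_) (½+½ ε) (ℚ.+-mono-< a< b<)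

  ⊔ˡ : ∀ {m n k} → m ℕ.⊔ n ℕ.≤ k → m ℕ.≤ k
  ⊔ˡ {m} {n} = ℕ.≤-trans (ℕ.m≤m⊔n m n)

  ⊔ʳ : ∀ {m n k} → m ℕ.⊔ n ℕ.≤ k → n ℕ.≤ k
  ⊔ʳ {m} {n} = ℕ.≤-trans (ℕ.m≤n⊔m m n)

-- The real numbers: Cauchy sequences of rationals, two of them being
-- equal when their difference tends to 0.

record ℝ : Set where
  field
    seq    : ℕ → ℚ
    cauchy : ∀ ε → 0ℚ ℚ.< ε → ∃[ N ] (∀ m n → N ℕ.≤ m → N ℕ.≤ n →
             ℚ.∣ seq m ℚ.- seq n ∣ ℚ.< ε)

open ℝ public

infix 4 _≃_
record _≃_ (x y : ℝ) : Set where
  constructor mk≃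
  field
    close : ∀ ε → 0ℚ ℚ.< ε → ∃[ N ] (∀ n → N ℕ.≤ n →
            ℚ.∣ seq x n ℚ.- seq y n ∣ ℚ.< ε)

open _≃_ public

fromℚ : ℚ → ℝ
fromℚ q = record
  { seq    = λ _ → q
  ; cauchy = λ ε ε>0 → 0 , λ _ _ _ _ →
      subst (_< ε) (sym (cong ℚ.∣_∣ (ℚ.+-inverseʳ q))) ε>0
  }

fromℕ : ℕ → ℝ
fromℕ n = fromℚ (+ n ℚ./ 1)

infixl 6 _+ᴿ_
infixl 7 _*ᴿ_
infix  8 -ᴿ_

private
  eventually-bounded : ∀ x → ∃[ B ] 0ℚ < B ×
    (∃[ N ] (∀ n → N ℕ.≤ n → ℚ.∣ seq x n ∣ ≤ B))
  eventually-bounded x with cauchy x 1ℚ (ℚ.positive⁻¹ 1ℚ)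
  ... | N , c = ℚ.∣ seq x N ∣ ℚ.+ 1ℚ
              , ℚ.+-mono-≤-< (ℚ.0≤∣p∣ (seq x N)) (ℚ.positive⁻¹ 1ℚ)
              , N , λ n N≤n → ℚ.≤-trans (∣p∣≤∣q∣+∥p-q∥ (seq x n) (seq x N))
                  (ℚ.+-monoʳ-≤ ℚ.∣ seq x N ∣ (ℚ.<⇒≤ (c n N N≤n ℕ.≤-refl)))

_+ᴿ_ : ℝ → ℝ → ℝ
x +ᴿ y = record
  { seq    = λ n → seq x n ℚ.+ seq y n
  ; cauchy = λ ε ε>0 →
      let M , p = cauchy x (½ ℚ.* ε) (½-pos ε>0)
          N , q = cauchy y (½ ℚ.* ε) (½-pos ε>0)
      in M ℕ.⊔ N , λ m n ≤m ≤n →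
         ℚ.≤-<-trans (∥+∥ (seq x m) (seq y m) (seq x n) (seq y n))
           (split (p m n (⊔ˡ ≤m) (⊔ˡ ≤n))
                  (q m n (⊔ʳ {M} ≤m) (⊔ʳ {M} ≤n)))
  }

-ᴿ_ : ℝ → ℝ
-ᴿ x = record
  { seq    = λ n → ℚ.- seq x n
  ; cauchy = λ ε ε>0 →
      let N , p = cauchy x ε ε>0
      in N , λ m n ≤m ≤n →
         subst (_< ε) (sym (∥-_∥ (seq x m) (seq x n))) (p m n ≤m ≤n)
  }

_*ᴿ_ : ℝ → ℝ → ℝ
x *ᴿ y = record
  { seq    = λ n → seq x n ℚ.* seq y n
  ; cauchy = λ ε ε>0 →
      let A , A>0 , K , bx = eventually-bounded x
          B , B>0 , L , by = eventually-bounded y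
          δ , δ>0 , sx     = shrink A>0 (½-pos ε>0)
          η , η>0 , sy     = shrink B>0 (½-pos ε>0)
          M , p            = cauchy x η η>0
          N , q            = cauchy y δ δ>0
      in (K ℕ.⊔ L) ℕ.⊔ (M ℕ.⊔ N) , λ m n ≤m ≤n →
         ℚ.≤-<-trans (∥*∥ (seq x m) (seq y m) (seq x n) (seq y n))
           (split
             (sx {seq x m} (bx m (⊔ˡ {K} (⊔ˡ ≤m))) (ℚ.0≤∣p∣ (seq y m ℚ.- seq y n))
                 (q m n (⊔ʳ {M} (⊔ʳ {K ℕ.⊔ L} ≤m)) (⊔ʳ {M} (⊔ʳ {K ℕ.⊔ L} ≤n))))
             (sy {seq y n} (by n (⊔ʳ {K} (⊔ˡ ≤n))) (ℚ.0≤∣p∣ (seq x m ℚ.- seq x n))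
                 (p m n (⊔ˡ {M} (⊔ʳ {K ℕ.⊔ L} ≤m)) (⊔ˡ {M} (⊔ʳ {K ℕ.⊔ L} ≤n)))))
  }

∣_∣ᴿ : ℝ → ℝ
∣ x ∣ᴿ = record
  { seq    = λ n → ℚ.∣ seq x n ∣
  ; cauchy = λ ε ε>0 →
      let N , p = cauchy x ε ε>0
      in N , λ m n ≤m ≤n →
         ℚ.≤-<-trans (∥∣∣∥ (seq x m) (seq x n)) (p m n ≤m ≤n)
  }

pointwise : ∀ {x y} → (∀ n → seq x n ≡ seq y n) → x ≃ y
pointwise {x} {y} eq = mk≃ λ ε ε>0 → 0 , λ n _ →
  subst (_< ε) (sym (cong ℚ.∣_∣ (lem (eq n)))) ε>0
  where
  lem : ∀ {p q} → p ≡ q → p ℚ.- q ≡ 0ℚ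
  lem {p} refl = ℚ.+-inverseʳ p

≃-isEquivalence : IsEquivalence _≃_
≃-isEquivalence = record
  { refl  = pointwise (λ _ → refl)
  ; sym   = λ {x} {y} x≃y → mk≃ λ ε ε>0 →
      let N , p = close x≃y ε ε>0
      in N , λ n ≤n → subst (_< ε) (∥-∥-sym (seq x n) (seq y n)) (p n ≤n)
  ; trans = λ {x} {y} {z} x≃y y≃z → mk≃ λ ε ε>0 →
      let M , p = close x≃y (½ ℚ.* ε) (½-pos ε>0)
          N , q = close y≃z (½ ℚ.* ε) (½-pos ε>0)
      in M ℕ.⊔ N , λ n ≤n →
         ℚ.≤-<-trans (∥-∥-triangle (seq x n) (seq y n) (seq z n))
           (split (p n (⊔ˡ ≤n)) (q n (⊔ʳ {M} ≤n)))
  }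

+ᴿ-cong : ∀ {x x′ y y′} → x ≃ x′ → y ≃ y′ → x +ᴿ y ≃ x′ +ᴿ y′
+ᴿ-cong {x} {x′} {y} {y′} x≃ y≃ = mk≃ λ ε ε>0 →
  let M , p = close x≃ (½ ℚ.* ε) (½-pos ε>0)
      N , q = close y≃ (½ ℚ.* ε) (½-pos ε>0)
  in M ℕ.⊔ N , λ n ≤n →
     ℚ.≤-<-trans (∥+∥ (seq x n) (seq y n) (seq x′ n) (seq y′ n))
       (split (p n (⊔ˡ ≤n)) (q n (⊔ʳ {M} ≤n)))

-ᴿ-cong : ∀ {x y} → x ≃ y → -ᴿ x ≃ -ᴿ y
-ᴿ-cong {x} {y} x≃y = mk≃ λ ε ε>0 →
  let N , p = close x≃y ε ε>0
  in N , λ n ≤n → subst (_< ε) (sym (∥-_∥ (seq x n) (seq y n))) (p n ≤n)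

*ᴿ-cong : ∀ {x x′ y y′} → x ≃ x′ → y ≃ y′ → x *ᴿ y ≃ x′ *ᴿ y′
*ᴿ-cong {x} {x′} {y} {y′} x≃ y≃ = mk≃ λ ε ε>0 →
  let A , A>0 , K , bx = eventually-bounded x
      B , B>0 , L , by = eventually-bounded y′
      δ , δ>0 , sx     = shrink A>0 (½-pos ε>0)
      η , η>0 , sy     = shrink B>0 (½-pos ε>0)
      M , p            = close x≃ η η>0
      N , q            = close y≃ δ δ>0
  in (K ℕ.⊔ L) ℕ.⊔ (M ℕ.⊔ N) , λ n ≤n →
     ℚ.≤-<-trans (∥*∥ (seq x n) (seq y n) (seq x′ n) (seq y′ n))
       (split
         (sx {seq x n} (bx n (⊔ˡ {K} (⊔ˡ ≤n))) (ℚ.0≤∣p∣ (seq y n ℚ.- seq y′ n))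
             (q n (⊔ʳ {M} (⊔ʳ {K ℕ.⊔ L} ≤n))))
         (sy {seq y′ n} (by n (⊔ʳ {K} (⊔ˡ ≤n))) (ℚ.0≤∣p∣ (seq x n ℚ.- seq x′ n))
             (p n (⊔ˡ {M} (⊔ʳ {K ℕ.⊔ L} ≤n)))))

∣∣ᴿ-cong : ∀ {x y} → x ≃ y → ∣ x ∣ᴿ ≃ ∣ y ∣ᴿ
∣∣ᴿ-cong {x} {y} x≃y = mk≃ λ ε ε>0 →
  let N , p = close x≃y ε ε>0
  in N , λ n ≤n → ℚ.≤-<-trans (∥∣∣∥ (seq x n) (seq y n)) (p n ≤n)

ℝ-commutativeRing : CommutativeRing 0ℓ 0ℓ
ℝ-commutativeRing = record
  { Carrier = ℝ
  ; _≈_ = _≃_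
  ; _+_ = _+ᴿ_
  ; _*_ = _*ᴿ_
  ; -_  = -ᴿ_
  ; 0#  = fromℚ 0ℚ
  ; 1#  = fromℚ 1ℚ
  ; isCommutativeRing = record
    { isRing = record
      { +-isAbelianGroup = record
        { isGroup = record
          { isMonoid = record
            { isSemigroup = record
              { isMagma = record
                { isEquivalence = ≃-isEquivalence
                ; ∙-cong = +ᴿ-cong
                }
              ; assoc = λ x y z → pointwise λ n → ℚ.+-assoc (seq x n) (seq y n) (seq z n)
              }
            ; identity = (λ x → pointwise λ n → ℚ.+-identityˡ (seq x n))
                       , (λ x → pointwise λ n → ℚ.+-identityʳ (seq x n))
            }
          ; inverse = (λ x → pointwise λ n → ℚ.+-inverseˡ (seq x n))
                    , (λ x → pointwise λ n → ℚ.+-inverseʳ (seq x n))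
          ; ⁻¹-cong = -ᴿ-cong
          }
        ; comm = λ x y → pointwise λ n → ℚ.+-comm (seq x n) (seq y n)
        }
      ; *-cong = *ᴿ-cong
      ; *-assoc = λ x y z → pointwise λ n → ℚ.*-assoc (seq x n) (seq y n) (seq z n)
      ; *-identity = (λ x → pointwise λ n → ℚ.*-identityˡ (seq x n))
                   , (λ x → pointwise λ n → ℚ.*-identityʳ (seq x n))
      ; distrib = (λ x y z → pointwise λ n → ℚ.*-distribˡ-+ (seq x n) (seq y n) (seq z n))
                , (λ x y z → pointwise λ n → ℚ.*-distribʳ-+ (seq x n) (seq y n) (seq z n))
      }
    ; *-comm = λ x y → pointwise λ n → ℚ.*-comm (seq x n) (seq y n)
    }
  }

open CommutativeRing ℝ-commutativeRing using (_+_; _*_; _-_; -_; 0#; 1#; semiring)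
open RawSemiringDefs (Semiring.rawSemiring semiring) using (sum; product; _^_)

Matrix : ℕ → Set
Matrix n = Fin n → Fin n → ℝ

-- Laplace expansion along the first row.
det : ∀ {n} → Matrix n → ℝ
det {zero}  A = 1#
det {suc n} A = sum λ j →
  ((- 1#) ^ toℕ j) * A zero j * det (λ i k → A (suc i) (punchIn j k))

scalar : ∀ {n} → ℝ → Matrix n
scalar x i j = if does (i ≟ j) then x else 0#

charPoly : ∀ {n} → Matrix n → ℝ → ℝ
charPoly A x = det (λ i j → scalar x i j - A i j)

-- λs enumerates the eigenvalues of A, each repeated according to its
-- multiplicity as a root of the characteristic polynomial.  (Polynomials
-- over ℝ are determined by their values.)  Such an enumeration is unique
-- up to reordering, and every reordering of it qualifies as well.
IsSpectrum : ∀ {n} → Matrix n → Vector ℝ n → Set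
IsSpectrum A λs = ∀ x → charPoly A x ≃ product (λ i → x - λs i)

module _ {n : ℕ} (_~_ : Rel (Fin n) 0ℓ) where

  data Walk : ℕ → Fin n → Fin n → Set where
    []  : ∀ {u} → Walk 0 u u
    _∷_ : ∀ {k u v w} → u ~ v → Walk k v w → Walk (suc k) u w

record Graph (n : ℕ) : Set₁ where
  infix 4 _~_ _~?_
  field
    _~_       : Rel (Fin n) 0ℓ
    _~?_      : Decidable _~_
    ~-sym     : Symmetric _~_
    ~-irrefl  : Irreflexive _≡_ _~_
    connected : ∀ u v → ∃[ k ] Walk _~_ k u v

  walk? : ∀ k u v → Dec (Walk _~_ k u v)
  walk? zero u v with u ≟ v
  ... | yes refl = yes []
  ... | no  u≢v  = no λ { [] → u≢v refl }
  walk? (suc k) u v with any? (λ w → (u ~? w) ×-dec walk? k w v)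
  ... | yes (w , u~w , p) = yes (u~w ∷ p)
  ... | no  ¬walk         = no λ { (u~w ∷ p) → ¬walk (_ , u~w , p) }

  IsDistance : Fin n → Fin n → ℕ → Set
  IsDistance u v d = Walk _~_ d u v × (∀ k → Walk _~_ k u v → d ℕ.≤ k)

  private
    least : ∀ {P : Pred ℕ 0ℓ} → U.Decidable P → ∀ {k} → P k →
            ∃[ m ] (P m × (∀ j → P j → m ℕ.≤ j))
    least P? {zero}  pk = 0 , pk , λ _ _ → z≤n
    least P? {suc k} pk with P? 0
    ... | yes p0 = 0 , p0 , λ _ _ → z≤n
    ... | no ¬p0 with least (P? ∘ suc) pk
    ...   | m , pm , min = suc m , pm , λ where
            zero    p0 → contradiction p0 ¬p0
            (suc j) pj → s≤s (min j pj)

  distance : ∀ u v → ∃[ d ] IsDistance u v d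
  distance u v = least (λ k → walk? k u v) (proj₂ (connected u v))

  dist : Fin n → Fin n → ℕ
  dist u v = proj₁ (distance u v)

  ecc : Fin n → ℕ
  ecc v = foldr ℕ._⊔_ 0 (λ u → dist v u)

  eccentricityMatrix : Matrix n
  eccentricityMatrix u v =
    if does (dist u v ℕ.≟ ecc u ℕ.⊓ ecc v) then fromℕ (dist u v) else 0#

  IsεSpectrum : Vector ℝ n → Set
  IsεSpectrum = IsSpectrum eccentricityMatrix

  IsεEnergy : ℝ → Set
  IsεEnergy E = ∃[ λs ] (IsεSpectrum λs × E ≃ sum (λ i → ∣ λs i ∣ᴿ))

infix 4 _≅_
_≅_ : ∀ {n} → Graph n → Graph n → Set
_≅_ {n} G H = ∃[ π ] (∀ u v → (u G.~ v) ⇔ ((π ⟨$⟩ʳ u) H.~ (π ⟨$⟩ʳ v)))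
  where
  module G = Graph G
  module H = Graph H

Sameε-Spectrum : ∀ {n} → Graph n → Graph n → Set
Sameε-Spectrum G H = ∃[ λs ] (Graph.IsεSpectrum G λs × Graph.IsεSpectrum H λs)

-- Cospectrality is a notion for non-isomorphic graphs, and so is its
-- negation.
Nonε-Cospectral : ∀ {n} → Graph n → Graph n → Set
Nonε-Cospectral G H = ¬ (G ≅ H) × ¬ Sameε-Spectrum G H

ε-Equienergetic : ∀ {n} → Graph n → Graph n → Set
ε-Equienergetic G H = ∃[ E ] (Graph.IsεEnergy G E × Graph.IsεEnergy H E)

-- Equality of the unordered pairs {G₁ , H₁} and {G₂ , H₂} up to isomorphism.
SamePair : ∀ {n} → Graph n → Graph n → Graph n → Graph n → Set
SamePair G₁ H₁ G₂ H₂ = (G₁ ≅ G₂ × H₁ ≅ H₂) ⊎ (G₁ ≅ H₂ × H₁ ≅ G₂)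

{-# OPTIONS --safe #-}
-- Let C be a graph without isolated vertices in which any two adjacent
-- vertices have a common non-neighbour.  All vertices of the complement of C
-- have eccentricity 2, so its eccentricity matrix is twice the adjacency
-- matrix of C.  The graphs K₂ ∪ K₂ and C₄ = K₂,₂ have the same order and the
-- same energy 4, but only the second has the eigenvalue 2.  Hence, with m = 3t + 3, the
-- complements of m K₂, of C₄ ∪ (m − 2) K₂ and of 2 C₄ ∪ (m − 4) K₂ all have
-- ε-energy 4m; the first is not ε-cospectral to the other two, and the
-- number of vertices of degree at least 2 in C tells all three apart.

module Submission where

open import Defs
open import Algebra.Bundles using (CommutativeRing; Monoid; RawRing; Semiring)
import Algebra.Definitions.RawSemiring as RawSemiringDefs
import Algebra.Properties.Group as GroupProperties
import Algebra.Properties.Monoid.Sum as MonoidSum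
import Algebra.Properties.Semiring.Sum as SemiringSum
open import Data.Bool.Base using (Bool; true; false; if_then_else_; _xor_)
import Data.Bool.Properties as Bool
open import Data.Fin.Base using (Fin; zero; suc; toℕ; punchIn; _↑ˡ_; _↑ʳ_)
open import Data.Fin.Patterns
open import Data.Fin.Permutation using (_⟨$⟩ʳ_)
open import Data.Fin.Properties as Fin using (_≟_)
open import Data.Integer.Base using (+_)
open import Data.List.Base using (List; []; _∷_; replicate)
open import Data.Nat.Base as ℕ using (ℕ; zero; suc; z≤n; s≤s)
import Data.Nat.Properties as ℕ
import Data.Nat.Tactic.RingSolver as ℕ-Solver
open import Data.Product.Base using (∃₂; ∃-syntax; _×_; _,_; proj₁; proj₂)
open import Data.Rational.Base as ℚ using (ℚ; 0ℚ; 1ℚ)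
import Data.Rational.Properties as ℚ
open import Data.Rational.Solver using (module +-*-Solver)
open import Data.Sum.Base using (inj₁; inj₂)
open import Data.Vec.Functional as Vec using (Vector; foldr; _++_)
open import Data.Vec.Functional.Properties using (lookup-++ˡ; lookup-++ʳ)
open import Function.Base using (_∘_)
open import Function.Bundles using (Equivalence; Injection)
open import Function.Properties.Inverse using (↔⇒↣)
import Level
open import Relation.Nullary using (¬_; yes; no; does; contradiction)
open import Relation.Nullary.Decidable using (dec-true; dec-false; _×-dec_; ¬?)
open import Relation.Binary.PropositionalEquality
  using (_≡_; _≢_; refl; sym; trans; cong; cong₂; subst)

private
  variable
    m n : ℕ

-- Index sets with two blocks

data SplitView m {n} : Fin (m ℕ.+ n) → Set where
  left  : ∀ i → SplitView m (i ↑ˡ n)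
  right : ∀ j → SplitView m (m ↑ʳ j)

splitView : ∀ m {n} (u : Fin (m ℕ.+ n)) → SplitView m u
splitView zero    u       = right u
splitView (suc m) zero    = left zero
splitView (suc m) (suc u) with splitView m u
... | left i  = left (suc i)
... | right j = right j

↑ˡ≢↑ʳ : (i : Fin m) (j : Fin n) → i ↑ˡ n ≢ m ↑ʳ j
↑ˡ≢↑ʳ (suc i) j eq = ↑ˡ≢↑ʳ i j (Fin.suc-injective eq)

punchIn-↑ˡ : (i : Fin (suc m)) (j : Fin m) →
             punchIn (i ↑ˡ n) (j ↑ˡ n) ≡ punchIn i j ↑ˡ n
punchIn-↑ˡ zero    j       = refl
punchIn-↑ˡ (suc i) zero    = refl
punchIn-↑ˡ (suc i) (suc j) = cong suc (punchIn-↑ˡ i j)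

punchIn-↑ʳ : (i : Fin (suc m)) (j : Fin n) →
             punchIn (i ↑ˡ n) (m ↑ʳ j) ≡ suc m ↑ʳ j
punchIn-↑ʳ         zero    j = refl
punchIn-↑ʳ {suc m} (suc i) j = cong suc (punchIn-↑ʳ i j)

module _ {c ℓ} (M : Monoid c ℓ) where

  open Monoid M hiding (refl; sym; trans)
  open MonoidSum M
  private module M = Monoid M

  -- Stated for monoids so as to serve both the products of linear factors and the sums of absolute
  -- values of eigenvalues.
  sum-split : ∀ m (f : Vector Carrier (m ℕ.+ n)) →
              sum f ≈ sum (λ (i : Fin m) → f (i ↑ˡ n)) ∙ sum (λ j → f (m ↑ʳ j))
  sum-split zero    f = M.sym (identityˡ _)
  sum-split (suc m) f = M.trans (∙-congˡ (sum-split m (f ∘ suc))) (M.sym (assoc _ _ _))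

-- Determinants and spectra of block matrices

module Spectral {c ℓ} (R : RawRing c ℓ) where

  open RawRing R
  open RawSemiringDefs rawSemiring using (sum; product; _^_)

  Mat : ℕ → Set c
  Mat n = Fin n → Fin n → Carrier

  -- The same expansion as `det`, so that the terms of the Cauchy sequence of a real determinant are
  -- determinants over ℚ. Coefficients in a `RawRing` also admit the syntactic polynomials of the
  -- ring solver.
  determinant : Mat n → Carrier
  determinant {zero}  A = 1#
  determinant {suc n} A = sum λ j →
    ((- 1#) ^ toℕ j) * A zero j * determinant (λ i k → A (suc i) (punchIn j k))

  scalarMat : Carrier → Mat n
  scalarMat x i j = if does (i ≟ j) then x else 0#

  characteristic : Mat n → Carrier → Carrier
  characteristic A x = determinant (λ i j → scalarMat x i j + - A i j)

  rootPoly : Vector Carrier n → Carrier → Carrier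
  rootPoly λs x = product (λ i → x + - λs i)

  HasSpectrum : Mat n → Vector Carrier n → Set (c Level.⊔ ℓ)
  HasSpectrum A λs = ∀ x → characteristic A x ≈ rootPoly λs x

module SpectralProperties {c ℓ} (R : CommutativeRing c ℓ) where

  open CommutativeRing R hiding (zero; refl; sym; trans)
  open CommutativeRing R using () renaming (refl to ≈-refl; sym to ≈-sym; trans to ≈-trans)
  open Spectral rawRing
  open SemiringSum semiring
  open MonoidSum *-monoid using () renaming (sum-cong-≋ to product-cong)
  open RawSemiringDefs (Semiring.rawSemiring semiring) using (_^_)
  open import Relation.Binary.Reasoning.Setoid setoid

  sum-vanishing-↑ʳ : ∀ m (f : Vector Carrier (m ℕ.+ n)) → (∀ j → f (m ↑ʳ j) ≈ 0#) →
                     sum f ≈ sum (λ (i : Fin m) → f (i ↑ˡ n))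
  sum-vanishing-↑ʳ {n} zero f f≈0 =
    ≈-trans (sum-cong-≋ f≈0) (sum-replicate-zero n)
  sum-vanishing-↑ʳ (suc m) f f≈0 = +-congˡ (sum-vanishing-↑ʳ m (f ∘ suc) f≈0)

  rootPoly-++ : (λs : Vector Carrier m) (μs : Vector Carrier n) → ∀ x →
                rootPoly (λs ++ μs) x ≈ rootPoly λs x * rootPoly μs x
  rootPoly-++ {m} {n} λs μs x = ≈-trans
    (sum-split *-monoid m (λ i → x - (λs ++ μs) i))
    (*-cong
      (product-cong λ i → reflexive (cong (λ y → x - y) (lookup-++ˡ λs μs i)))
      (product-cong λ i → reflexive (cong (λ y → x - y) (lookup-++ʳ λs μs i))))

  determinant-cong : {A B : Mat n} → (∀ i j → A i j ≈ B i j) → determinant A ≈ determinant B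
  determinant-cong {zero}  A≈B = ≈-refl
  determinant-cong {suc n} A≈B = sum-cong-≋ λ j →
    *-cong (*-congˡ {(- 1#) ^ toℕ j} (A≈B zero j)) (determinant-cong λ i k → A≈B (suc i) (punchIn j k))

  -- Induction on the size of the first block. In the expansion along the first row only columns of
  -- the first block contribute, and each minor keeps the lower right block `D`, which factors out
  -- of the sum.
  determinant-blockTriangular : ∀ m (A : Mat (m ℕ.+ n)) →
    (∀ i j → A (i ↑ˡ n) (m ↑ʳ j) ≈ 0#) →
    determinant A ≈ determinant (λ (i j : Fin m) → A (i ↑ˡ n) (j ↑ˡ n)) *
                    determinant (λ i j → A (m ↑ʳ i) (m ↑ʳ j))
  determinant-blockTriangular zero A A≈0 = ≈-sym (*-identityˡ _)
  determinant-blockTriangular {n} (suc m) A A≈0 = begin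
    sum term
      ≈⟨ sum-vanishing-↑ʳ (suc m) term (λ j → begin
           _           ≈⟨ *-congʳ (*-congˡ (A≈0 zero j)) ⟩
           _ * 0# * _  ≈⟨ *-congʳ (zeroʳ _) ⟩
           0# * _      ≈⟨ zeroˡ _ ⟩
           0#          ∎) ⟩
    sum (λ j → term (j ↑ˡ n))
      ≈⟨ sum-cong-≋ expand ⟩
    sum (λ j → cofactor j * determinant D)
      ≈⟨ *-distribʳ-sum (determinant D) cofactor ⟨
    sum cofactor * determinant D ∎
    where
    D : Mat n
    D i j = A (suc m ↑ʳ i) (suc m ↑ʳ j)

    term : Vector Carrier (suc m ℕ.+ n)
    term j = ((- 1#) ^ toℕ j) * A zero j *
             determinant (λ i k → A (suc i) (punchIn j k))

    cofactor : Vector Carrier (suc m)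
    cofactor j = ((- 1#) ^ toℕ j) * A zero (j ↑ˡ n) *
                 determinant (λ i k → A (suc i ↑ˡ n) (punchIn j k ↑ˡ n))

    expand : ∀ j → term (j ↑ˡ n) ≈ cofactor j * determinant D
    expand j = begin
      term (j ↑ˡ n)
        -- Removing a column of the first block leaves the last n columns intact, so the minor is
        -- again block triangular.
        ≈⟨ *-congˡ (determinant-blockTriangular m minor λ i k →
             ≈-trans (reflexive (cong (A (suc i ↑ˡ n)) (punchIn-↑ʳ j k)))
                     (A≈0 (suc i) k)) ⟩
      sgn (toℕ (j ↑ˡ n)) * a * (determinant minor₁ * determinant minor₂)
        ≡⟨ cong (λ k → sgn k * a * (determinant minor₁ * determinant minor₂)) (Fin.toℕ-↑ˡ j n) ⟩
      sgn (toℕ j) * a * (determinant minor₁ * determinant minor₂)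
        ≈⟨ *-assoc _ _ _ ⟨
      sgn (toℕ j) * a * determinant minor₁ * determinant minor₂
        ≈⟨ *-cong
             (*-congˡ (determinant-cong λ i k →
               reflexive (cong (A (suc i ↑ˡ n)) (punchIn-↑ˡ j k))))
             (determinant-cong λ i k →
               reflexive (cong (A (suc m ↑ʳ i)) (punchIn-↑ʳ j k))) ⟩
      cofactor j * determinant D ∎
      where
      sgn : ℕ → Carrier
      sgn k = (- 1#) ^ k
      a : Carrier
      a = A zero (j ↑ˡ n)
      minor : Mat (m ℕ.+ n)
      minor i k = A (suc i) (punchIn (j ↑ˡ n) k)
      minor₁ : Mat m
      minor₁ i k = minor (i ↑ˡ n) (k ↑ˡ n)
      minor₂ : Mat n
      minor₂ i k = minor (m ↑ʳ i) (m ↑ʳ k)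

  scalarMat-injective : ∀ (f : Fin m → Fin n) → (∀ {i j} → f i ≡ f j → i ≡ j) →
                        ∀ x i j → scalarMat x (f i) (f j) ≡ scalarMat x i j
  scalarMat-injective f f-inj x i j with i ≟ j
  ... | yes i≡j rewrite dec-true  (f i ≟ f j) (cong f i≡j)  = refl
  ... | no  i≢j rewrite dec-false (f i ≟ f j) (i≢j ∘ f-inj) = refl

  scalarMat-≢ : ∀ x {i j : Fin n} → i ≢ j → scalarMat x i j ≡ 0#
  scalarMat-≢ x {i} {j} i≢j rewrite dec-false (i ≟ j) i≢j = refl

  -- The matrix x minus `M` is block triangular, so its determinant is the product of the two
  -- characteristic polynomials; `rootPoly` likewise turns concatenation into a product.
  HasSpectrum-⊕ : (A : Mat m) (B : Mat n) (M : Mat (m ℕ.+ n)) →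
    (∀ i j → M (i ↑ˡ n) (j ↑ˡ n) ≈ A i j) →
    (∀ i j → M (i ↑ˡ n) (m ↑ʳ j) ≈ 0#) →
    (∀ i j → M (m ↑ʳ i) (m ↑ʳ j) ≈ B i j) →
    ∀ {λs μs} → HasSpectrum A λs → HasSpectrum B μs → HasSpectrum M (λs ++ μs)
  HasSpectrum-⊕ {m} {n} A B M M₁₁ M₁₂ M₂₂ {λs} {μs} A-spec B-spec x = begin
    characteristic M x
      ≈⟨ determinant-blockTriangular m _ (λ i j → begin
           _       ≈⟨ +-cong (reflexive (scalarMat-≢ x (↑ˡ≢↑ʳ i j))) (-‿cong (M₁₂ i j)) ⟩
           0# - 0# ≈⟨ -‿inverseʳ 0# ⟩
           0#      ∎) ⟩
    _
      ≈⟨ *-cong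
           (determinant-cong λ i j → +-cong
             (reflexive (scalarMat-injective (_↑ˡ n) (Fin.↑ˡ-injective n _ _) x i j))
             (-‿cong (M₁₁ i j)))
           (determinant-cong λ i j → +-cong
             (reflexive (scalarMat-injective (m ↑ʳ_) (Fin.↑ʳ-injective m _ _) x i j))
             (-‿cong (M₂₂ i j))) ⟩
    characteristic A x * characteristic B x
      ≈⟨ *-cong (A-spec x) (B-spec x) ⟩
    rootPoly λs x * rootPoly μs x
      ≈⟨ rootPoly-++ λs μs x ⟨
    rootPoly (λs ++ μs) x ∎

-- From rational to real spectra

private
  module ℝR where
    open CommutativeRing ℝ-commutativeRing public
    open RawSemiringDefs (Semiring.rawSemiring semiring) public using (sum; product; _^_)

  module ℚ+ = RawSemiringDefs (Semiring.rawSemiring (CommutativeRing.semiring ℚ.+-*-commutativeRing))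

open Spectral (CommutativeRing.rawRing ℚ.+-*-commutativeRing)
open SpectralProperties ℚ.+-*-commutativeRing

-- Real addition, negation and multiplication act termwise on Cauchy sequences, so taking the k-th
-- term commutes with every expression built from them, in particular with determinants.
seq-sum : (f : Vector ℝ n) → ∀ k → seq (ℝR.sum f) k ≡ ℚ+.sum (λ i → seq (f i) k)
seq-sum {zero}  f k = refl
seq-sum {suc n} f k = cong (seq (f zero) k ℚ.+_) (seq-sum (f ∘ suc) k)

seq-product : (f : Vector ℝ n) → ∀ k → seq (ℝR.product f) k ≡ ℚ+.product (λ i → seq (f i) k)
seq-product {zero}  f k = refl
seq-product {suc n} f k = cong (seq (f zero) k ℚ.*_) (seq-product (f ∘ suc) k)

seq-^ : ∀ x j k → seq (x ℝR.^ j) k ≡ seq x k ℚ+.^ j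
seq-^ x zero    k = refl
seq-^ x (suc j) k = cong (seq x k ℚ.*_) (seq-^ x j k)

seq-det : (A : Matrix n) → ∀ k → seq (det A) k ≡ determinant (λ i j → seq (A i j) k)
seq-det {zero}  A k = refl
seq-det {suc n} A k = trans
  (seq-sum (λ j → ((ℝR.- ℝR.1#) ℝR.^ toℕ j) ℝR.* A zero j ℝR.* det (λ i l → A (suc i) (punchIn j l))) k)
  (sum-cong λ j → cong₂ ℚ._*_
    (cong (ℚ._* seq (A zero j) k) (seq-^ (ℝR.- ℝR.1#) (toℕ j) k))
    (seq-det (λ i l → A (suc i) (punchIn j l)) k))
  where open MonoidSum ℚ.+-0-monoid using () renaming (sum-cong-≗ to sum-cong)

seq-scalar : ∀ x (i j : Fin n) k → seq (scalar x i j) k ≡ scalarMat (seq x k) i j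
seq-scalar x i j k with does (i ≟ j)
... | true  = refl
... | false = refl

seq-rootPoly : (λs : Vector ℚ n) → ∀ x k →
               seq (ℝR.product (λ i → x ℝR.- fromℚ (λs i))) k ≡ rootPoly λs (seq x k)
seq-rootPoly {n} λs x k = seq-product {n} _ k

seq-charPoly : {M : Matrix n} (A : Mat n) → (∀ i j → M i j ≡ fromℚ (A i j)) →
               ∀ x k → seq (charPoly M x) k ≡ characteristic A (seq x k)
seq-charPoly {M = M} A M≡A x k = trans
  (seq-det (λ i j → scalar x i j ℝR.- M i j) k)
  (determinant-cong
    λ i j → cong₂ ℚ._-_ (seq-scalar x i j k) (cong (λ y → seq y k) (M≡A i j)))

-- The k-th terms of both sides are the two sides of the rational identity at the k-th approximation
-- of `x`. They are equal for every k, so no limit argument arises.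
HasSpectrum⇒IsSpectrum : {M : Matrix n} (A : Mat n) → (∀ i j → M i j ≡ fromℚ (A i j)) →
                         ∀ {λs} → HasSpectrum A λs → IsSpectrum M (λ i → fromℚ (λs i))
HasSpectrum⇒IsSpectrum A M≡A {λs} A-spec x =
  pointwise λ k → trans (seq-charPoly A M≡A x k)
    (trans (A-spec (seq x k)) (sym (seq-rootPoly λs x k)))

-- If p and q differ, take the absolute value of their difference as ε: the two constant sequences
-- never come closer than that.
fromℚ-injective : ∀ {p q} → fromℚ p ≃ fromℚ q → p ≡ q
fromℚ-injective {p} {q} p≃q with p ℚ.≟ q
... | yes p≡q = p≡q
... | no  p≢q = contradiction (near N ℕ.≤-refl) (ℚ.<-irrefl refl)
  where
  ε>0 : 0ℚ ℚ.< ℚ.∣ p ℚ.- q ∣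
  ε>0 = ℚ.≰⇒> λ ∣p-q∣≤0 → p≢q (x∙y⁻¹≈ε⇒x≈y p q
    (ℚ.∣p∣≡0⇒p≡0 (p ℚ.- q) (ℚ.≤-antisym ∣p-q∣≤0 (ℚ.0≤∣p∣ (p ℚ.- q)))))
    where open GroupProperties (CommutativeRing.+-group ℚ.+-*-commutativeRing)
  N    = proj₁ (close p≃q ℚ.∣ p ℚ.- q ∣ ε>0)
  near = proj₂ (close p≃q ℚ.∣ p ℚ.- q ∣ ε>0)

-- Complements of graphs in which adjacent vertices have a common non-neighbour

-- The value 2 is the distance in the complement between vertices adjacent in the original graph.
weight : Bool → ℚ
weight b = if b then + 2 ℚ./ 1 else 0ℚ

foldr-⊔-lub : (f : Vector ℕ n) → ∀ {k} → (∀ i → f i ℕ.≤ k) → foldr ℕ._⊔_ 0 f ℕ.≤ k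
foldr-⊔-lub {zero}  f f≤k = z≤n
foldr-⊔-lub {suc n} f f≤k = ℕ.⊔-lub (f≤k zero) (foldr-⊔-lub (f ∘ suc) (f≤k ∘ suc))

lookup≤foldr-⊔ : (f : Vector ℕ n) → ∀ i → f i ℕ.≤ foldr ℕ._⊔_ 0 f
lookup≤foldr-⊔ f zero    = ℕ.m≤m⊔n _ _
lookup≤foldr-⊔ f (suc i) = ℕ.≤-trans (lookup≤foldr-⊔ (f ∘ suc) i) (ℕ.m≤n⊔m (f zero) _)

-- Two minimal walk lengths bound each other. This reads off a distance from a shortest walk,
-- without evaluating the search that defines `dist`.
dist-unique : (G : Graph n) → ∀ {u v d} → Graph.IsDistance G u v d → Graph.dist G u v ≡ d
dist-unique G {u} {v} (walk , shortest) = ℕ.≤-antisym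
  (proj₂ (proj₂ (Graph.distance G u v)) _ walk)
  (shortest _ (proj₁ (proj₂ (Graph.distance G u v))))

-- The graph whose complement is to be taken: `detour` bounds the distances in the complement by 2,
-- and `neighbour` makes every vertex attain the bound.
record Complementable (n : ℕ) : Set where
  field
    adj        : Fin n → Fin n → Bool
    adj-sym    : ∀ u v → adj u v ≡ adj v u
    adj-irrefl : ∀ u → adj u u ≡ false
    neighbour  : ∀ u → ∃[ v ] adj u v ≡ true
    detour     : ∀ u v → adj u v ≡ true →
                 ∃[ w ] ((u ≢ w × adj u w ≡ false) × (w ≢ v × adj w v ≡ false))

module _ (C : Complementable n) where

  open Complementable C

  private
    Coadj : Fin n → Fin n → Set
    Coadj u v = u ≢ v × adj u v ≡ false

    -- The cases correspond to the distances 0, 1 and 2 in the complement.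
    data Position (u : Fin n) : Fin n → Set where
      same     : Position u u
      coadj    : ∀ {v} → Coadj u v → Position u v
      adjacent : ∀ {v} → adj u v ≡ true → Position u v

    position : ∀ u v → Position u v
    position u v with u ≟ v | adj u v in eq
    ... | yes refl | _     = same
    ... | no  u≢v  | false = coadj (u≢v , eq)
    ... | no  u≢v  | true  = adjacent eq

    adj⇒≢ : ∀ {u v} → adj u v ≡ true → u ≢ v
    adj⇒≢ {u} uv refl with () ← trans (sym uv) (adj-irrefl u)

  complement : Graph n
  complement = record
    { _~_       = Coadj
    ; _~?_      = λ u v → ¬? (u ≟ v) ×-dec (adj u v Bool.≟ false)
    ; ~-sym     = λ (u≢v , uv) → (u≢v ∘ sym) , trans (adj-sym _ _) uv
    ; ~-irrefl  = λ u≡v (u≢v , _) → u≢v u≡v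
    ; connected = λ u v → walk (position u v)
    }
    where
    walk : ∀ {u v} → Position u v → ∃[ k ] Walk Coadj k u v
    walk same          = 0 , []
    walk (coadj u~v)   = 1 , u~v ∷ []
    walk (adjacent uv) = let w , u~w , w~v = detour _ _ uv in 2 , u~w ∷ (w~v ∷ [])

  private
    module G = Graph complement

    dist-same : ∀ u → G.dist u u ≡ 0
    dist-same u = dist-unique complement {u} {u} ([] , λ _ _ → z≤n)

    dist-coadj : ∀ {u v} → Coadj u v → G.dist u v ≡ 1
    dist-coadj u~v = dist-unique complement (u~v ∷ [] , λ where
      zero    []      → contradiction refl (proj₁ u~v)
      (suc k) _       → s≤s z≤n)

    dist-adjacent : ∀ {u v} → adj u v ≡ true → G.dist u v ≡ 2
    dist-adjacent uv = dist-unique complement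
      ( (let w , u~w , w~v = detour _ _ uv in u~w ∷ (w~v ∷ []))
      , λ where
          zero          []             → contradiction refl (adj⇒≢ uv)
          (suc zero)    ((_ , ¬uv) ∷ []) → contradiction (trans (sym uv) ¬uv) λ ()
          (suc (suc k)) _              → s≤s (s≤s z≤n))

    dist≤2 : ∀ {u v} → Position u v → G.dist u v ℕ.≤ 2
    dist≤2 {u} same      = ℕ.≤-trans (ℕ.≤-reflexive (dist-same u)) z≤n
    dist≤2 (coadj u~v)   = ℕ.≤-trans (ℕ.≤-reflexive (dist-coadj u~v)) (s≤s z≤n)
    dist≤2 (adjacent uv) = ℕ.≤-reflexive (dist-adjacent uv)

  ecc-complement : ∀ u → G.ecc u ≡ 2
  ecc-complement u = ℕ.≤-antisym (foldr-⊔-lub (G.dist u) (λ v → dist≤2 (position u v)))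
    (let v , uv = neighbour u in
     ℕ.≤-trans (ℕ.≤-reflexive (sym (dist-adjacent uv))) (lookup≤foldr-⊔ (G.dist u) v))

  -- As all eccentricities are 2, exactly the entries at distance 2 survive, and these belong to the
  -- pairs adjacent in `C`.
  eccentricityMatrix-complement :
    ∀ u v → G.eccentricityMatrix u v ≡ fromℚ (weight (adj u v))
  eccentricityMatrix-complement u v = trans
    (cong₂ (λ d e → if does (G.dist u v ℕ.≟ d ℕ.⊓ e) then fromℕ (G.dist u v) else fromℚ 0ℚ)
           (ecc-complement u) (ecc-complement v))
    (entry (position u v))
    where
    entry : ∀ {u v} → Position u v →
            (if does (G.dist u v ℕ.≟ 2) then fromℕ (G.dist u v) else fromℚ 0ℚ)
            ≡ fromℚ (weight (adj u v))
    entry {u} same      rewrite dist-same u | adj-irrefl u = refl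
    entry (coadj u~v)   rewrite dist-coadj u~v | proj₂ u~v = refl
    entry (adjacent uv) rewrite dist-adjacent uv | uv      = refl

-- By contraposition: the images of u and v are distinct, so if they were not adjacent in `D` they
-- would be adjacent in its complement, and pulling back would make u and v non-adjacent in `C`.
complement-≅ : (C D : Complementable n) → ((π , _) : complement C ≅ complement D) →
  ∀ {u v} → Complementable.adj C u v ≡ true → Complementable.adj D (π ⟨$⟩ʳ u) (π ⟨$⟩ʳ v) ≡ true
complement-≅ C D (π , ~⇔~) {u} {v} uv with Complementable.adj D (π ⟨$⟩ʳ u) (π ⟨$⟩ʳ v) in eq
... | true  = refl
... | false = contradiction (trans (sym uv) (proj₂ (Equivalence.from (~⇔~ u v) (πu≢πv , eq)))) λ ()
  where
  πu≢πv : π ⟨$⟩ʳ u ≢ π ⟨$⟩ʳ v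
  πu≢πv πu≡πv with Injection.injective (↔⇒↣ π) πu≡πv
  ... | refl with () ← trans (sym uv) (Complementable.adj-irrefl C u)

-- Degree at least 2, expressed by two witnesses so that an isomorphism carries it over without any
-- counting.
Branching : Complementable n → Fin n → Set
Branching C u = ∃₂ λ v w → v ≢ w × adj u v ≡ true × adj u w ≡ true
  where open Complementable C

branching-≅ : (C D : Complementable n) → ((π , _) : complement C ≅ complement D) →
              ∀ u → Branching C u → Branching D (π ⟨$⟩ʳ u)
branching-≅ C D iso@(π , _) u (v , w , v≢w , uv , uw) =
  π ⟨$⟩ʳ v , π ⟨$⟩ʳ w , (v≢w ∘ Injection.injective (↔⇒↣ π)) ,
  complement-≅ C D iso uv , complement-≅ C D iso uw

-- Disjoint unions of copies of K₂ and C₄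

data Block : Set where
  K₂ C₄ : Block

size : Block → ℕ
size K₂ = 2
size C₄ = 4

-- The bipartition of the complete bipartite graph K₂ = K₁,₁ or C₄ = K₂,₂.
side : ∀ b → Fin (size b) → Bool
side K₂ zero          = false
side K₂ (suc _)       = true
side C₄ zero          = false
side C₄ (suc zero)    = false
side C₄ (suc (suc _)) = true

blockAdj : ∀ b → Fin (size b) → Fin (size b) → Bool
blockAdj b i j = side b i xor side b j

order : List Block → ℕ
order []       = 0
order (b ∷ bs) = size b ℕ.+ order bs

-- A block diagonal matrix: the outer `++` chooses the block of the row, the inner ones that of the
-- column.
unionAdj : ∀ bs → Fin (order bs) → Fin (order bs) → Bool
unionAdj (b ∷ bs) =
  (λ i → blockAdj b i ++ λ _ → false) ++ (λ i → (λ _ → false) ++ unionAdj bs i)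

module _ (b : Block) (bs : List Block) where

  private
    inˡ : Fin (size b) → Fin (order (b ∷ bs))
    inˡ i = i ↑ˡ order bs

    inʳ : Fin (order bs) → Fin (order (b ∷ bs))
    inʳ = size b ↑ʳ_

    row-inˡ : ∀ i → unionAdj (b ∷ bs) (inˡ i) ≡ (blockAdj b i ++ λ _ → false)
    row-inˡ = lookup-++ˡ _ _

    row-inʳ : ∀ i → unionAdj (b ∷ bs) (inʳ i) ≡ ((λ _ → false) ++ unionAdj bs i)
    row-inʳ = lookup-++ʳ {m = size b} _ _

  unionAdj-ˡˡ : ∀ i j → unionAdj (b ∷ bs) (inˡ i) (inˡ j) ≡ blockAdj b i j
  unionAdj-ˡˡ i j = trans (cong (λ r → r (inˡ j)) (row-inˡ i)) (lookup-++ˡ (blockAdj b i) _ j)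

  unionAdj-ˡʳ : ∀ i j → unionAdj (b ∷ bs) (inˡ i) (inʳ j) ≡ false
  unionAdj-ˡʳ i j = trans (cong (λ r → r (inʳ j)) (row-inˡ i)) (lookup-++ʳ (blockAdj b i) _ j)

  unionAdj-ʳˡ : ∀ i j → unionAdj (b ∷ bs) (inʳ i) (inˡ j) ≡ false
  unionAdj-ʳˡ i j = trans (cong (λ r → r (inˡ j)) (row-inʳ i)) (lookup-++ˡ _ (unionAdj bs i) j)

  unionAdj-ʳʳ : ∀ i j → unionAdj (b ∷ bs) (inʳ i) (inʳ j) ≡ unionAdj bs i j
  unionAdj-ʳʳ i j = trans (cong (λ r → r (inʳ j)) (row-inʳ i)) (lookup-++ʳ {m = size b} _ (unionAdj bs i) j)

unionAdj-sym : ∀ bs u v → unionAdj bs u v ≡ unionAdj bs v u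
unionAdj-sym (b ∷ bs) u v with splitView (size b) u | splitView (size b) v
... | left i  | left j  = trans (unionAdj-ˡˡ b bs i j)
  (trans (Bool.xor-comm (side b i) (side b j)) (sym (unionAdj-ˡˡ b bs j i)))
... | left i  | right j = trans (unionAdj-ˡʳ b bs i j) (sym (unionAdj-ʳˡ b bs j i))
... | right i | left j  = trans (unionAdj-ʳˡ b bs i j) (sym (unionAdj-ˡʳ b bs j i))
... | right i | right j = trans (unionAdj-ʳʳ b bs i j)
  (trans (unionAdj-sym bs i j) (sym (unionAdj-ʳʳ b bs j i)))

unionAdj-irrefl : ∀ bs u → unionAdj bs u u ≡ false
unionAdj-irrefl (b ∷ bs) u with splitView (size b) u
... | left i  = trans (unionAdj-ˡˡ b bs i i) (Bool.xor-same (side b i))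
... | right i = trans (unionAdj-ʳʳ b bs i i) (unionAdj-irrefl bs i)

blockNeighbour : ∀ b i → ∃[ j ] blockAdj b i j ≡ true
blockNeighbour K₂ zero          = suc zero , refl
blockNeighbour K₂ (suc zero)    = zero , refl
blockNeighbour C₄ zero          = suc (suc zero) , refl
blockNeighbour C₄ (suc zero)    = suc (suc zero) , refl
blockNeighbour C₄ (suc (suc _)) = zero , refl

unionNeighbour : ∀ bs u → ∃[ v ] unionAdj bs u v ≡ true
unionNeighbour (b ∷ bs) u with splitView (size b) u
... | left i  = let j , ij = blockNeighbour b i in j ↑ˡ order bs , trans (unionAdj-ˡˡ b bs i j) ij
... | right i = let j , ij = unionNeighbour bs i in size b ↑ʳ j , trans (unionAdj-ʳʳ b bs i j) ij

firstVertex : ∀ b → Fin (size b)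
firstVertex K₂ = zero
firstVertex C₄ = zero

-- Adjacent vertices lie in the same block, so any vertex of another block
-- is a common non-neighbour.
unionDetour : ∀ b c bs u v → let adj = unionAdj (b ∷ c ∷ bs) in adj u v ≡ true →
              ∃[ w ] ((u ≢ w × adj u w ≡ false) × (w ≢ v × adj w v ≡ false))
unionDetour b c bs u v uv with splitView (size b) u | splitView (size b) v
... | left i  | left j  = size b ↑ʳ w ,
  (↑ˡ≢↑ʳ i w , unionAdj-ˡʳ b (c ∷ bs) i w) ,
  (↑ˡ≢↑ʳ j w ∘ sym , unionAdj-ʳˡ b (c ∷ bs) w j)
  where w = firstVertex c ↑ˡ order bs
... | right i | right j = w ↑ˡ order (c ∷ bs) ,
  (↑ˡ≢↑ʳ w i ∘ sym , unionAdj-ʳˡ b (c ∷ bs) i w) ,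
  (↑ˡ≢↑ʳ w j , unionAdj-ˡʳ b (c ∷ bs) w j)
  where w = firstVertex b
... | left i  | right j = contradiction (trans (sym uv) (unionAdj-ˡʳ b (c ∷ bs) i j)) λ ()
... | right i | left j  = contradiction (trans (sym uv) (unionAdj-ʳˡ b (c ∷ bs) i j)) λ ()

-- Two blocks are exposed because a detour between adjacent vertices runs through a different block.
union : ∀ b c bs → Complementable (order (b ∷ c ∷ bs))
union b c bs = record
  { adj        = unionAdj (b ∷ c ∷ bs)
  ; adj-sym    = unionAdj-sym (b ∷ c ∷ bs)
  ; adj-irrefl = unionAdj-irrefl (b ∷ c ∷ bs)
  ; neighbour  = unionNeighbour (b ∷ c ∷ bs)
  ; detour     = unionDetour b c bs
  }

-- Spectra and energies of the unions

2ℚ 4ℚ : ℚ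
2ℚ = + 2 ℚ./ 1
4ℚ = + 4 ℚ./ 1

-- Twice the adjacency eigenvalues, which are 1, -1 for K₂ and 2, -2, 0, 0 for C₄.
blockSpectrum : ∀ b → Vector ℚ (size b)
blockSpectrum K₂ = 2ℚ Vec.∷ ℚ.- 2ℚ Vec.∷ Vec.[]
blockSpectrum C₄ = 4ℚ Vec.∷ ℚ.- 4ℚ Vec.∷ 0ℚ Vec.∷ 0ℚ Vec.∷ Vec.[]

unionSpectrum : ∀ bs → Vector ℚ (order bs)
unionSpectrum []       = Vec.[]
unionSpectrum (b ∷ bs) = blockSpectrum b ++ unionSpectrum bs

private
  open +-*-Solver

  -- With solver syntax as coefficients, `Spectral` itself writes out the determinants as
  -- polynomials in one variable.
  polynomialRing : RawRing Level.zero Level.zero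
  polynomialRing = record
    { Carrier = Polynomial 1
    ; _≈_     = _≡_
    ; _+_     = _:+_
    ; _*_     = _:*_
    ; -_      = :-_
    ; 0#      = con 0ℚ
    ; 1#      = con 1ℚ
    }

  module Poly = Spectral polynomialRing

-- For a fixed block this is an identity of polynomials in x, settled by comparing normal forms.
blockSpectrum-correct : ∀ b → HasSpectrum (λ i j → weight (blockAdj b i j)) (blockSpectrum b)
blockSpectrum-correct K₂ = solve 1 (λ x →
  Poly.characteristic (λ i j → con (weight (blockAdj K₂ i j))) x :=
  Poly.rootPoly (con ∘ blockSpectrum K₂) x) refl
blockSpectrum-correct C₄ = solve 1 (λ x →
  Poly.characteristic (λ i j → con (weight (blockAdj C₄ i j))) x :=
  Poly.rootPoly (con ∘ blockSpectrum C₄) x) refl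

unionSpectrum-correct : ∀ bs → HasSpectrum (λ u v → weight (unionAdj bs u v)) (unionSpectrum bs)
unionSpectrum-correct []       x = refl
unionSpectrum-correct (b ∷ bs) = HasSpectrum-⊕
  (λ i j → weight (blockAdj b i j)) (λ i j → weight (unionAdj bs i j)) _
  (λ i j → cong weight (unionAdj-ˡˡ b bs i j))
  (λ i j → cong weight (unionAdj-ˡʳ b bs i j))
  (λ i j → cong weight (unionAdj-ʳʳ b bs i j))
  (blockSpectrum-correct b) (unionSpectrum-correct bs)

blockEnergy : Block → ℚ
blockEnergy K₂ = + 4 ℚ./ 1
blockEnergy C₄ = + 8 ℚ./ 1

unionEnergy : List Block → ℚ
unionEnergy []       = 0ℚ
unionEnergy (b ∷ bs) = blockEnergy b ℚ.+ unionEnergy bs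

unionEnergy-correct : ∀ bs → ℚ+.sum (λ i → ℚ.∣ unionSpectrum bs i ∣) ≡ unionEnergy bs
unionEnergy-correct []       = refl
unionEnergy-correct (b ∷ bs) = trans
  (sum-split ℚ.+-0-monoid (size b) (λ i → ℚ.∣ unionSpectrum (b ∷ bs) i ∣))
  (cong₂ ℚ._+_
    (trans (sum-cong λ i → cong ℚ.∣_∣ (lookup-++ˡ (blockSpectrum b) (unionSpectrum bs) i)) (energy b))
    (trans (sum-cong λ i → cong ℚ.∣_∣ (lookup-++ʳ (blockSpectrum b) (unionSpectrum bs) i))
           (unionEnergy-correct bs)))
  where
  open MonoidSum ℚ.+-0-monoid using () renaming (sum-cong-≗ to sum-cong)

  energy : ∀ b → ℚ+.sum (λ i → ℚ.∣ blockSpectrum b i ∣) ≡ blockEnergy b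
  energy K₂ = refl
  energy C₄ = refl

-- Records rather than synonyms: two such types are compared by their
-- parameters, and not by expanding determinants of size 8 and more.
record εCharPolyAt (G : Graph n) (q p : ℚ) : Set where
  constructor mkεCharPolyAt
  field
    value : charPoly (Graph.eccentricityMatrix G) (fromℚ q) ≃ fromℚ p

record RationalεEnergy (G : Graph n) (q : ℚ) : Set where
  constructor mkRationalεEnergy
  field
    isεEnergy : Graph.IsεEnergy G (fromℚ q)

module _ (G : Graph n) (λs : Vector ℚ n)
         (λs-spec : Graph.IsεSpectrum G (λ i → fromℚ (λs i))) where

  εSpectrum⇒εCharPolyAt : ∀ q → εCharPolyAt G q (rootPoly λs q)
  εSpectrum⇒εCharPolyAt q = mkεCharPolyAt
    (ℝR.trans (λs-spec (fromℚ q)) (pointwise λ k → seq-rootPoly {n} λs (fromℚ q) k))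

  εSpectrum⇒εEnergy : RationalεEnergy G (ℚ+.sum (λ i → ℚ.∣ λs i ∣))
  εSpectrum⇒εEnergy = mkRationalεEnergy
    ((λ i → fromℚ (λs i)) , λs-spec ,
     pointwise λ k → sym (seq-sum {n} (λ i → ∣ fromℚ (λs i) ∣ᴿ) k))

-- A common spectrum, whatever its real entries, forces both characteristic polynomials to agree at
-- `q`. Comparing values at one point thus avoids the uniqueness of spectra.
¬Sameε-Spectrum : (G H : Graph n) → ∀ {q p₁ p₂} →
  εCharPolyAt G q p₁ → εCharPolyAt H q p₂ → p₁ ≢ p₂ → ¬ Sameε-Spectrum G H
¬Sameε-Spectrum G H {q} (mkεCharPolyAt G-p₁) (mkεCharPolyAt H-p₂) p₁≢p₂ (νs , G-νs , H-νs) =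
  p₁≢p₂ (fromℚ-injective
    (ℝR.trans (ℝR.sym G-p₁) (ℝR.trans (G-νs (fromℚ q))
      (ℝR.trans (ℝR.sym (H-νs (fromℚ q))) H-p₂))))

RationalεEnergy⇒ε-Equienergetic : (G H : Graph n) → ∀ {p q} → p ≡ q →
  RationalεEnergy G p → RationalεEnergy H q → ε-Equienergetic G H
RationalεEnergy⇒ε-Equienergetic G H refl (mkRationalεEnergy G-p) (mkRationalεEnergy H-p) =
  _ , G-p , H-p

-- The point 4 is an eigenvalue of the block C₄ but not of K₂, where the value is (4 - 2)(4 + 2).
blockCharAt4 : Block → ℚ
blockCharAt4 K₂ = + 12 ℚ./ 1
blockCharAt4 C₄ = 0ℚ

unionCharAt4 : List Block → ℚ
unionCharAt4 []       = 1ℚ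
unionCharAt4 (b ∷ bs) = blockCharAt4 b ℚ.* unionCharAt4 bs

unionCharAt4-correct : ∀ bs → rootPoly (unionSpectrum bs) 4ℚ ≡ unionCharAt4 bs
unionCharAt4-correct []       = refl
unionCharAt4-correct (b ∷ bs) = trans
  (rootPoly-++ (blockSpectrum b) (unionSpectrum bs) 4ℚ)
  (cong₂ ℚ._*_ (charAt4 b) (unionCharAt4-correct bs))
  where
  charAt4 : ∀ b → rootPoly (blockSpectrum b) 4ℚ ≡ blockCharAt4 b
  charAt4 K₂ = refl
  charAt4 C₄ = refl

unionCharAt4-C₄∷ : ∀ bs → unionCharAt4 (C₄ ∷ bs) ≡ 0ℚ
unionCharAt4-C₄∷ bs = ℚ.*-zeroˡ (unionCharAt4 bs)

-- The value is a power of 12. Positivity passes to products and separates it from 0, the value in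
-- the presence of C₄.
unionCharAt4-K₂s : ∀ k → ℚ.Positive (unionCharAt4 (replicate k K₂))
unionCharAt4-K₂s zero    = _
unionCharAt4-K₂s (suc k) =
  ℚ.pos*pos⇒pos (+ 12 ℚ./ 1) (unionCharAt4 (replicate k K₂)) {{unionCharAt4-K₂s k}}

-- Since 4 + 4 evaluates to 8, only associativity remains.
unionEnergy-C₄∷ : ∀ bs → unionEnergy (C₄ ∷ bs) ≡ unionEnergy (K₂ ∷ K₂ ∷ bs)
unionEnergy-C₄∷ bs = ℚ.+-assoc (blockEnergy K₂) (blockEnergy K₂) (unionEnergy bs)

module _ (b c : Block) (bs : List Block) where

  private
    λs : Vector ℚ (order (b ∷ c ∷ bs))
    λs = unionSpectrum (b ∷ c ∷ bs)

  unionGraph : Graph (order (b ∷ c ∷ bs))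
  unionGraph = complement (union b c bs)

  unionGraph-εSpectrum : Graph.IsεSpectrum unionGraph (λ i → fromℚ (λs i))
  unionGraph-εSpectrum = HasSpectrum⇒IsSpectrum
    {M = Graph.eccentricityMatrix unionGraph} (λ u v → weight (unionAdj (b ∷ c ∷ bs) u v))
    (eccentricityMatrix-complement (union b c bs))
    {λs} (unionSpectrum-correct (b ∷ c ∷ bs))

  unionGraph-εCharPolyAt : εCharPolyAt unionGraph 4ℚ (unionCharAt4 (b ∷ c ∷ bs))
  unionGraph-εCharPolyAt = subst (εCharPolyAt unionGraph 4ℚ)
    (unionCharAt4-correct (b ∷ c ∷ bs))
    (εSpectrum⇒εCharPolyAt unionGraph λs unionGraph-εSpectrum 4ℚ)

  unionGraph-εEnergy : RationalεEnergy unionGraph (unionEnergy (b ∷ c ∷ bs))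
  unionGraph-εEnergy = subst (RationalεEnergy unionGraph)
    (unionEnergy-correct (b ∷ c ∷ bs))
    (εSpectrum⇒εEnergy unionGraph λs unionGraph-εSpectrum)

-- Vertices of degree at least 2 in the unions

Matching : List Block → Set
Matching bs = ∀ u v w → unionAdj bs u v ≡ true → unionAdj bs u w ≡ true → v ≡ w

-- Both neighbours lie on the same side of the splitting as `u`: either in K₂, where a vertex has
-- one neighbour only, or in the rest, which is a matching.
matching-K₂∷ : ∀ bs → Matching bs → Matching (K₂ ∷ bs)
matching-K₂∷ bs matching u v w uv uw with splitView 2 u | splitView 2 v | splitView 2 w
... | left i  | left j  | left l  = cong (_↑ˡ order bs) (unique i j l
  (trans (sym (unionAdj-ˡˡ K₂ bs i j)) uv) (trans (sym (unionAdj-ˡˡ K₂ bs i l)) uw))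
  where
  unique : ∀ i j l → blockAdj K₂ i j ≡ true → blockAdj K₂ i l ≡ true → j ≡ l
  unique 0F 1F 1F _ _ = refl
  unique 1F 0F 0F _ _ = refl
... | right i | right j | right l = cong (2 ↑ʳ_) (matching i j l
  (trans (sym (unionAdj-ʳʳ K₂ bs i j)) uv) (trans (sym (unionAdj-ʳʳ K₂ bs i l)) uw))
... | left i  | right j | _       = contradiction (trans (sym uv) (unionAdj-ˡʳ K₂ bs i j)) λ ()
... | right i | left j  | _       = contradiction (trans (sym uv) (unionAdj-ʳˡ K₂ bs i j)) λ ()
... | left i  | left _  | right l = contradiction (trans (sym uw) (unionAdj-ˡʳ K₂ bs i l)) λ ()
... | right i | right _ | left l  = contradiction (trans (sym uw) (unionAdj-ʳˡ K₂ bs i l)) λ ()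

matching-K₂s : ∀ k → Matching (replicate k K₂)
matching-K₂s zero    ()
matching-K₂s (suc k) = matching-K₂∷ (replicate k K₂) (matching-K₂s k)

-- A vertex outside the first block has its neighbours outside it too, and there the matching makes
-- any two of them equal.
branching⇒↑ˡ : ∀ b c bs → Matching (c ∷ bs) → ∀ u → Branching (union b c bs) u →
               ∃[ i ] u ≡ i ↑ˡ order (c ∷ bs)
branching⇒↑ˡ b c bs matching u (v , w , v≢w , uv , uw)
  with splitView (size b) u | splitView (size b) v | splitView (size b) w
... | left i  | _       | _       = i , refl
... | right i | left j  | _       = contradiction (trans (sym uv) (unionAdj-ʳˡ b (c ∷ bs) i j)) λ ()
... | right i | right _ | left l  = contradiction (trans (sym uw) (unionAdj-ʳˡ b (c ∷ bs) i l)) λ ()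
... | right i | right j | right l = contradiction
  (cong (size b ↑ʳ_) (matching i j l
    (trans (sym (unionAdj-ʳʳ b (c ∷ bs) i j)) uv) (trans (sym (unionAdj-ʳʳ b (c ∷ bs) i l)) uw)))
  v≢w

-- The two pairs

record TwoPairs (n : ℕ) : Set₁ where
  constructor mkTwoPairs
  field
    pairs : ∃[ G₁ ] ∃[ H₁ ] ∃[ G₂ ] ∃[ H₂ ]
      ( (Nonε-Cospectral {n} G₁ H₁ × ε-Equienergetic G₁ H₁)
      × (Nonε-Cospectral {n} G₂ H₂ × ε-Equienergetic G₂ H₂)
      × ¬ SamePair G₁ H₁ G₂ H₂ )

-- The pairs are {`G₂`, `G₀`} and {`G₁`, `G₀`}. Were they the same, `G₂` would be isomorphic to `G₁`
-- or to `G₀`.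
twoPairs : (G₀ G₁ G₂ : Graph n) → ∀ {x p₀ p₁ p₂ e₀ e₁ e₂} →
  εCharPolyAt G₀ x p₀ → εCharPolyAt G₁ x p₁ → εCharPolyAt G₂ x p₂ →
  p₁ ≢ p₀ → p₂ ≢ p₀ →
  RationalεEnergy G₀ e₀ → RationalεEnergy G₁ e₁ → RationalεEnergy G₂ e₂ →
  e₁ ≡ e₀ → e₂ ≡ e₀ →
  ¬ G₁ ≅ G₀ → ¬ G₂ ≅ G₀ → ¬ G₂ ≅ G₁ → TwoPairs n
twoPairs G₀ G₁ G₂ c₀ c₁ c₂ p₁≢p₀ p₂≢p₀ E₀ E₁ E₂ e₁≡e₀ e₂≡e₀ G₁≇G₀ G₂≇G₀ G₂≇G₁ = mkTwoPairs (
  G₂ , G₀ , G₁ , G₀ ,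
  ((G₂≇G₀ , ¬Sameε-Spectrum G₂ G₀ c₂ c₀ p₂≢p₀) ,
   RationalεEnergy⇒ε-Equienergetic G₂ G₀ e₂≡e₀ E₂ E₀) ,
  ((G₁≇G₀ , ¬Sameε-Spectrum G₁ G₀ c₁ c₀ p₁≢p₀) ,
   RationalεEnergy⇒ε-Equienergetic G₁ G₀ e₁≡e₀ E₁ E₀) ,
  λ { (inj₁ (G₂≅G₁ , _)) → G₂≇G₁ G₂≅G₁ ; (inj₂ (G₂≅G₀ , _)) → G₂≇G₀ G₂≅G₀ })

module _ (k : ℕ) where

  private
    bs : List Block
    bs = replicate k K₂

    -- The leading blocks have total size 2 + 2 + 2 + 2, 4 + 2 + 2 and 4 + 4, so the three orders
    -- agree by evaluation.
    C₀ C₁ C₂ : Complementable (8 ℕ.+ order bs)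
    C₀ = union K₂ K₂ (K₂ ∷ K₂ ∷ bs)
    C₁ = union C₄ K₂ (K₂ ∷ bs)
    C₂ = union C₄ C₄ bs

    ¬branching₀ : ∀ u → ¬ Branching C₀ u
    ¬branching₀ u (v , w , v≢w , uv , uw) = v≢w (matching-K₂s (4 ℕ.+ k) u v w uv uw)

    -- The two copies of C₄ have the sides {0, 1}, {2, 3} and {4, 5}, {6, 7}; the witnesses form the
    -- opposite side.
    branching₂ : ∀ (i : Fin 8) → Branching C₂ (i ↑ˡ order bs)
    branching₂ zero = 2F , 3F , (λ ()) , refl , refl
    branching₂ 1F   = 2F , 3F , (λ ()) , refl , refl
    branching₂ 2F   = 0F , 1F , (λ ()) , refl , refl
    branching₂ 3F   = 0F , 1F , (λ ()) , refl , refl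
    branching₂ 4F   = 6F , 7F , (λ ()) , refl , refl
    branching₂ 5F   = 6F , 7F , (λ ()) , refl , refl
    branching₂ 6F   = 4F , 5F , (λ ()) , refl , refl
    branching₂ 7F   = 4F , 5F , (λ ()) , refl , refl

    branching₁ : Branching C₁ 0F
    branching₁ = 2F , 3F , (λ ()) , refl , refl

    energy₁ : unionEnergy (C₄ ∷ K₂ ∷ K₂ ∷ bs) ≡ unionEnergy (K₂ ∷ K₂ ∷ K₂ ∷ K₂ ∷ bs)
    energy₁ = unionEnergy-C₄∷ (K₂ ∷ K₂ ∷ bs)

    energy₂ : unionEnergy (C₄ ∷ C₄ ∷ bs) ≡ unionEnergy (K₂ ∷ K₂ ∷ K₂ ∷ K₂ ∷ bs)
    energy₂ = trans
      (cong (blockEnergy C₄ ℚ.+_) (unionEnergy-C₄∷ bs)) (unionEnergy-C₄∷ (K₂ ∷ K₂ ∷ bs))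

    C₁≇C₀ : ¬ complement C₁ ≅ complement C₀
    C₁≇C₀ iso@(π , _) = ¬branching₀ (π ⟨$⟩ʳ 0F) (branching-≅ C₁ C₀ iso 0F branching₁)

    C₂≇C₀ : ¬ complement C₂ ≅ complement C₀
    C₂≇C₀ iso@(π , _) = ¬branching₀ (π ⟨$⟩ʳ 0F) (branching-≅ C₂ C₀ iso 0F (branching₂ 0F))

    -- The eight branching vertices of C₂ would have to inject into the four
    -- of C₁.
    C₂≇C₁ : ¬ complement C₂ ≅ complement C₁
    C₂≇C₁ iso@(π , _) =
      let i , j , i<j , fi≡fj = Fin.pigeonhole 4<8 f
      in Fin.<⇒≢ i<j (Fin.↑ˡ-injective _ i j (Injection.injective (↔⇒↣ π)
           (trans (f-spec i) (trans (cong (_↑ˡ _) fi≡fj) (sym (f-spec j))))))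
      where
      4<8 : 4 ℕ.< 8
      4<8 = s≤s (s≤s (s≤s (s≤s (s≤s z≤n))))

      image : ∀ (i : Fin 8) → ∃[ j ] π ⟨$⟩ʳ (i ↑ˡ order bs) ≡ j ↑ˡ _
      image i = branching⇒↑ˡ C₄ K₂ (K₂ ∷ bs) (matching-K₂s (2 ℕ.+ k)) (π ⟨$⟩ʳ (i ↑ˡ order bs))
        (branching-≅ C₂ C₁ iso (i ↑ˡ order bs) (branching₂ i))

      f      = proj₁ ∘ image
      f-spec = proj₂ ∘ image

    charAt4≢ : ∀ cs → unionCharAt4 (C₄ ∷ cs) ≢ unionCharAt4 (replicate (4 ℕ.+ k) K₂)
    charAt4≢ cs eq with () ←
      subst ℚ.Positive (trans (sym eq) (unionCharAt4-C₄∷ cs)) (unionCharAt4-K₂s (4 ℕ.+ k))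

  twoPairs-K₂s : TwoPairs (8 ℕ.+ order bs)
  twoPairs-K₂s = twoPairs
    (unionGraph K₂ K₂ (K₂ ∷ K₂ ∷ bs)) (unionGraph C₄ K₂ (K₂ ∷ bs)) (unionGraph C₄ C₄ bs)
    (unionGraph-εCharPolyAt K₂ K₂ (K₂ ∷ K₂ ∷ bs))
    (unionGraph-εCharPolyAt C₄ K₂ (K₂ ∷ bs))
    (unionGraph-εCharPolyAt C₄ C₄ bs)
    (charAt4≢ (K₂ ∷ K₂ ∷ bs)) (charAt4≢ (C₄ ∷ bs))
    (unionGraph-εEnergy K₂ K₂ (K₂ ∷ K₂ ∷ bs))
    (unionGraph-εEnergy C₄ K₂ (K₂ ∷ bs))
    (unionGraph-εEnergy C₄ C₄ bs)
    energy₁ energy₂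
    C₁≇C₀ C₂≇C₀ C₂≇C₁

order-K₂s : ∀ k → order (replicate k K₂) ≡ k ℕ.* 2
order-K₂s zero    = refl
order-K₂s (suc k) = cong (2 ℕ.+_) (order-K₂s k)

twoPairs-6+6t : ∀ t → 3 ℕ.≤ t → TwoPairs (6 ℕ.+ 6 ℕ.* t)
-- With t = s + 1 and k = 2 + 3s further copies of K₂, the order 8 + 2k is 12 + 6s = 6 + 6t.
twoPairs-6+6t (suc s) _ = subst TwoPairs
  (trans (cong (8 ℕ.+_) (order-K₂s (2 ℕ.+ 3 ℕ.* s))) (arithmetic s))
  (twoPairs-K₂s (2 ℕ.+ 3 ℕ.* s))
  where
  arithmetic : ∀ s → 8 ℕ.+ (2 ℕ.+ 3 ℕ.* s) ℕ.* 2 ≡ 6 ℕ.+ 6 ℕ.* suc s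
  arithmetic = ℕ-Solver.solve-∀

open import Data.Nat.Base using (_+_; _*_; _≤_)

corollary5p6 : ∀ (t : ℕ) → 3 ≤ t →
    ∃[ G₁ ] ∃[ H₁ ] ∃[ G₂ ] ∃[ H₂ ]
    ( (Nonε-Cospectral {6 + 6 * t} G₁ H₁ × ε-Equienergetic G₁ H₁)
    × (Nonε-Cospectral {6 + 6 * t} G₂ H₂ × ε-Equienergetic G₂ H₂)
    × ¬ SamePair G₁ H₁ G₂ H₂ )
corollary5p6 t 3≤t = TwoPairs.pairs (twoPairs-6+6t t 3≤t)
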